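{- Let $S$ and $T$ be trees of height $\omega_1$ with $S\le T$. Then: (i) $NS^T\le_K NS^S$, and (ii) if $S$ is a nonspecial $\omega_1$-tree, then $\diamondsuit_S$ implies $\diamondsuit_T$.
   Context: A tree is a partial order $(T,<_T)$ in which the set of predecessors of each node is well-ordered; every tree is assumed to have a root, denoted $\emptyset$. For $t\in T$, $t{\downarrow}=\{s\in T\mid s<_T t\}$, $\mathrm{ht}(t)$ is the order type of $t{\downarrow}$, and $T_\alpha$ is the set of nodes of height $\alpha$. The height of $T$ is the least $\alpha$ with $T_\alpha=\emptyset$. An $\omega_1$-tree is a tree of height $\omega_1$ all of whose levels $T_\alpha$ are countable. For trees $S,T$, write $S\le T$ if there is a strictly increasing map $g:S\to T$, i.e. $s<_S t$ implies $g(s)<_T g(t)$. An antichain is a set of pairwise incomparable nodes. A set $U\subseteq T$ is special if it is a union of at most countably many antichains; otherwise it is nonspecial. (If $S\le T$ and $S$ is nonspecial then $T$ is nonspecial, so $\diamondsuit_T$ makes sense in (ii).) For $X\subseteq T$, a map $f:X\to T$ is regressive if $f(t)<_T t$ for all $t\in X\setminus\{\emptyset\}$. For $T$ of height $\omega_1$, $NS^T$ is the ideal of all $B\subseteq T$ for which there is a regressive $f:B\to T$ such that $f^{ -1}(\{t\})$ is special for every $t\in T$. Katětov order: for ideals $\mathcal I$ on $X$ and $\mathcal J$ on $Y$ (ideals are nonempty families closed under subsets and finite unions, not required to be proper), $\mathcal I\le_K\mathcal J$ means that there is $f:Y\to X$ with $f^{ -1}(A)\in\mathcal J$ for all $A\in\mathcal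 I$. For a nonspecial tree $T$ of height $\omega_1$, $\diamondsuit_T$ asserts that there is a sequence $(D_t\mid t\in T)$ with $D_t\subseteq t{\downarrow}$ for all $t\in T$ such that for every $X\subseteq T$, $\{t\in T\mid X\cap t{\downarrow}=D_t\}\notin NS^T$. -}

module Defs where

open import Axiom.ExcludedMiddle using (ExcludedMiddle)
open import Data.Empty.Polymorphic using (⊥)
open import Data.Nat.Base using (ℕ; zero; suc)
open import Data.Product.Base using (Σ-syntax; ∃; _×_; _,_; proj₁)
open import Data.Sum.Base as Sum using (_⊎_; inj₁; inj₂; [_,_]′)
open import Function.Base using (id; _on_)
open import Function.Bundles using (Injection)
open import Induction.WellFounded using (WellFounded)
open import Level using (Level; lift; lower) renaming (suc to lsuc)
open import Relation.Binary.Bundles using (Setoid; StrictTotalOrder)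
open import Relation.Binary.Core using (Rel)
import Relation.Binary.Construct.On as On
open import Relation.Binary.Morphism.Structures using (IsOrderIsomorphism)
open import Relation.Binary.PropositionalEquality using (_≡_; _≢_; refl; sym; cong; subst; setoid)
open import Relation.Binary.Structures using (IsStrictPartialOrder; IsStrictTotalOrder)
open import Relation.Nullary using (¬_; Dec; yes; no; contradiction)
open import Relation.Nullary.Decidable using (map′)
open import Relation.Unary using (Pred; _∈_; _⊆_; _≐_; _∪_; _∩_; _⊢_; ⋃; ｛_｝; Satisfiable; Empty)
open import Relation.Unary.Polymorphic using (U)

private
  variable
    ℓ : Level

-- Well-orders, playing the role of ordinals: two of them denote the same
-- ordinal when they are order isomorphic.  A well-order is taken up to the
-- setoid equality of the carrier.

record WellOrder ℓ : Set (lsuc ℓ) where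
  field
    strictTotalOrder : StrictTotalOrder ℓ ℓ ℓ
  open StrictTotalOrder strictTotalOrder public
    using (Carrier; _≈_; _<_; isStrictTotalOrder; module Eq)
  field
    wellFounded : WellFounded _<_

  ≈-setoid : Setoid ℓ ℓ
  ≈-setoid = Eq.setoid

-- α ↾ a is the ordinal represented by a ∈ α; up to isomorphism the
-- ordinals below α are exactly these.
_↾_ : (α : WellOrder ℓ) → WellOrder.Carrier α → WellOrder ℓ
α ↾ a = record
  { strictTotalOrder = On.strictTotalOrder (WellOrder.strictTotalOrder α)
                         (proj₁ {B = λ b → WellOrder._<_ α b a})
  ; wellFounded      = On.wellFounded proj₁ (WellOrder.wellFounded α)
  }

_≅_ : Rel (WellOrder ℓ) ℓ
α ≅ β = ∃ (IsOrderIsomorphism A._≈_ B._≈_ A._<_ B._<_)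
  where
  module A = WellOrder α
  module B = WellOrder β

Countable : Setoid ℓ ℓ → Set ℓ
Countable A = Injection A (setoid ℕ)

IsOmega₁ : Pred (WellOrder ℓ) ℓ
IsOmega₁ α = ¬ Countable (WellOrder.≈-setoid α)
           × (∀ a → Countable (WellOrder.≈-setoid (α ↾ a)))

record Tree ℓ : Set (lsuc ℓ) where
  infix 4 _<_
  field
    Node                 : Set ℓ
    _<_                  : Rel Node ℓ
    isStrictPartialOrder : IsStrictPartialOrder _≡_ _<_

  Below : Node → Pred Node ℓ
  Below t s = s < t

  field
    -- The predecessors of t form the Σ-type ∃ (Below t), whose elements are
    -- compared through their underlying nodes only, so that distinct
    -- proofs of s < t do not matter.
    below-isStrictTotalOrder : ∀ t →
      IsStrictTotalOrder (_≡_ on proj₁ {B = Below t}) (_<_ on proj₁)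
    below-wellFounded        : ∀ t → WellFounded (_<_ on proj₁ {B = Below t})
    root                     : Node
    root-least               : ∀ {t} → t ≢ root → root < t

  ht : Node → WellOrder ℓ
  ht t = record
    { strictTotalOrder = record { isStrictTotalOrder = below-isStrictTotalOrder t }
    ; wellFounded      = below-wellFounded t
    }

  Level[_] : WellOrder ℓ → Pred Node ℓ
  Level[ α ] t = ht t ≅ α

  -- A set of nodes as a setoid, forgetting the membership proofs.
  subset-setoid : Pred Node ℓ → Setoid ℓ ℓ
  subset-setoid P = On.setoid (setoid Node) (proj₁ {B = P})

  IsAntichain : Pred (Pred Node ℓ) ℓ
  IsAntichain A = ∀ {s t} → s ∈ A → t ∈ A → ¬ s < t

  -- Antichains may be empty, so ℕ-indexed unions cover the finite ones.
  Special : Pred (Pred Node ℓ) (lsuc ℓ)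
  Special B = Σ[ A ∈ (ℕ → Pred Node ℓ) ] (∀ n → IsAntichain (A n)) × B ≐ ⋃ ℕ A

  Regressive : Pred Node ℓ → (Node → Node) → Set ℓ
  Regressive B f = ∀ {t} → t ∈ B → t ≢ root → f t < t

  -- A regressive map B → T is given as a total map of which only the
  -- values on B matter; f⁻¹({u}) is therefore intersected with B.
  NS : Pred (Pred Node ℓ) (lsuc ℓ)
  NS B = Σ[ f ∈ (Node → Node) ] Regressive B f × (∀ u → Special (B ∩ (f ⊢ ｛ u ｝)))

  Nonspecial : Set (lsuc ℓ)
  Nonspecial = ¬ Special U

  -- α is the least ordinal whose level is empty.
  HasHeight : WellOrder ℓ → Set ℓ
  HasHeight α = Empty Level[ α ] × (∀ a → Satisfiable Level[ α ↾ a ])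

  HasHeightω₁ : Set (lsuc ℓ)
  HasHeightω₁ = Σ[ ω₁ ∈ WellOrder ℓ ] IsOmega₁ ω₁ × HasHeight ω₁

  Isω₁Tree : Set (lsuc ℓ)
  Isω₁Tree = HasHeightω₁ × (∀ α → Countable (subset-setoid Level[ α ]))

  ◇ : Set (lsuc ℓ)
  ◇ = Σ[ D ∈ (Node → Pred Node ℓ) ]
        (∀ t → D t ⊆ Below t)
      × (∀ (X : Pred Node ℓ) → ¬ NS (λ t → (X ∩ Below t) ≐ D t))

open Tree public using (HasHeightω₁; Isω₁Tree; Nonspecial; ◇)

infix 4 _≤ᵀ_

_≤ᵀ_ : Rel (Tree ℓ) ℓ
S ≤ᵀ T = Σ[ g ∈ (S.Node → T.Node) ] (∀ {s t} → s S.< t → g s T.< g t)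
  where
  module S = Tree S
  module T = Tree T

-- Ideals need not be proper.
record Ideal (X : Set ℓ) : Set (lsuc (lsuc ℓ)) where
  field
    member   : Pred (Pred X ℓ) (lsuc ℓ)
    nonempty : Satisfiable member
    ⊆-closed : ∀ {A B} → A ⊆ B → B ∈ member → A ∈ member
    ∪-closed : ∀ {A B} → A ∈ member → B ∈ member → (A ∪ B) ∈ member

infix 4 _≤K_

_≤K_ : {X Y : Set ℓ} → Ideal X → Ideal Y → Set (lsuc ℓ)
_≤K_ {X = X} {Y = Y} I J =
  Σ[ f ∈ (Y → X) ] (∀ A → A ∈ Ideal.member I → (f ⊢ A) ∈ Ideal.member J)

private
  unpair : ℕ → ℕ ⊎ ℕ
  unpair zero          = inj₁ zero
  unpair (suc zero)    = inj₂ zero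
  unpair (suc (suc n)) = Sum.map suc suc (unpair n)

  unpair-surjective : ∀ x → ∃ λ n → unpair n ≡ x
  unpair-surjective (inj₁ zero)    = 0 , refl
  unpair-surjective (inj₂ zero)    = 1 , refl
  unpair-surjective (inj₁ (suc k)) with n , eq ← unpair-surjective (inj₁ k) =
    suc (suc n) , cong (Sum.map suc suc) eq
  unpair-surjective (inj₂ (suc k)) with n , eq ← unpair-surjective (inj₂ k) =
    suc (suc n) , cong (Sum.map suc suc) eq

module _ (T : Tree ℓ) where
  open Tree T

  Special-⊆ : ∀ {B C} → B ⊆ C → Special C → Special B
  Special-⊆ {B} B⊆C (A , anti , C⊆A , _) =
    (λ n → B ∩ A n) ,
    (λ n (_ , p) (_ , q) → anti n p q) ,
    (λ b → let n , a = C⊆A (B⊆C b) in n , b , a) ,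
    (λ (_ , b , _) → b)

  Special-∪ : ∀ {B C} → Special B → Special C → Special (B ∪ C)
  Special-∪ {B} {C} (A , antiA , B⊆A , A⊆B) (A′ , antiA′ , C⊆A′ , A′⊆C) =
    (λ n → piece (unpair n)) ,
    (λ n → antichain (unpair n)) ,
    [ (λ b → let k , a = B⊆A b in at (inj₁ k) a)
    , (λ c → let k , a = C⊆A′ c in at (inj₂ k) a)
    ]′ ,
    (λ (n , p) → sound (unpair n) p)
    where
    piece : ℕ ⊎ ℕ → Pred Node _
    piece = [ A , A′ ]′

    antichain : ∀ x → IsAntichain (piece x)
    antichain (inj₁ k) = antiA k
    antichain (inj₂ k) = antiA′ k

    at : ∀ x {t} → t ∈ piece x → t ∈ ⋃ ℕ (λ n → piece (unpair n))
    at x {t} p with n , eq ← unpair-surjective x =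
      n , subst (λ y → t ∈ piece y) (sym eq) p

    sound : ∀ x {t} → t ∈ piece x → t ∈ (B ∪ C)
    sound (inj₁ k) a = inj₁ (A⊆B (k , a))
    sound (inj₂ k) a = inj₂ (A′⊆C (k , a))

  NS-∅ : NS (λ _ → ⊥)
  NS-∅ = id , (λ ()) , λ _ → (λ _ _ → ⊥) , (λ _ ()) , (λ ()) , (λ ())

  NS-⊆ : ∀ {B C} → B ⊆ C → NS C → NS B
  NS-⊆ B⊆C (f , reg , fib) =
    f , (λ b → reg (B⊆C b)) , (λ u → Special-⊆ (λ (b , e) → B⊆C b , e) (fib u))

  -- Gluing the two regressive maps needs membership in B to be decided.
  NS-∪ : ExcludedMiddle ℓ → ∀ {B C} → NS B → NS C → NS (B ∪ C)
  NS-∪ em {B} {C} (f , regf , fibf) (g , regg , fibg) =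
    (λ t → glue t em) , (λ {t} m → regressive t em m) ,
    (λ u → Special-⊆ (λ {t} (m , e) → fibre t em m e) (Special-∪ (fibf u) (fibg u)))
    where
    glue : ∀ t → Dec (t ∈ B) → Node
    glue t (yes _) = f t
    glue t (no  _) = g t

    regressive : ∀ t (d : Dec (t ∈ B)) → t ∈ (B ∪ C) → t ≢ root → glue t d < t
    regressive t (yes b) _        = regf b
    regressive t (no ¬b) (inj₁ b) = contradiction b ¬b
    regressive t (no ¬b) (inj₂ c) = regg c

    fibre : ∀ t (d : Dec (t ∈ B)) {u} → t ∈ (B ∪ C) → u ≡ glue t d →
            t ∈ ((B ∩ (f ⊢ ｛ u ｝)) ∪ (C ∩ (g ⊢ ｛ u ｝)))
    fibre t (yes b) _        e = inj₁ (b , e)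
    fibre t (no ¬b) (inj₁ b) e = contradiction b ¬b
    fibre t (no ¬b) (inj₂ c) e = inj₂ (c , e)

  NS-ideal : ExcludedMiddle (lsuc ℓ) → Ideal Node
  NS-ideal em = record
    { member   = NS
    ; nonempty = _ , NS-∅
    ; ⊆-closed = NS-⊆
    ; ∪-closed = NS-∪ (map′ lower lift em)
    }

-- A strictly increasing map S → T can be pushed down to a level preserving map
-- h, whose restrictions s↓ → h(s)↓ are order isomorphisms.  A regressive map f
-- on A ⊆ T then pulls back along h: send s to the unique s′ < s with
-- h(s′) = f(h(s)).  Its fibres lie in h-preimages of fibres of f, so h
-- witnesses NS^T ≤K NS^S.
--
-- For ◇ the fibres of h are countable, being contained in levels of S, so a
-- ◇_S-sequence induces countably many guesses at each t ∈ T.  As in Kunen's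
-- proof that ◇⁻ implies ◇, let it guess codes of sequences (Xₙ) of subsets of T
-- and let the n-th sequence on T guess Xₙ only: if each of these fails, at Xₙ
-- say, then the code of (Xₙ) is guessed on a set in the σ-ideal NS^S.  Codes
-- identify s↓ × ℕ with s↓ for s of limit height; other heights are negligible.
module Submission where

open import Defs
open import Axiom.ExcludedMiddle using (ExcludedMiddle)
open import Data.Empty using (⊥-elim)
open import Data.Nat.Base as ℕ using (ℕ; zero; z≤n; s≤s)
import Data.Nat.Properties as ℕ
open import Data.Product.Base using (Σ-syntax; ∃; ∃₂; _×_; _,_; proj₁; proj₂)
open import Data.Product.Properties using (,-injective)
open import Data.Sum.Base using (_⊎_; inj₁; inj₂)
open import Function.Base using (_∘_)
open import Function.Bundles using (Injection)
open import Induction.WellFounded using (WellFounded; Acc; acc)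
open import Level using (Level; suc; lift; lower)
open import Relation.Binary.Construct.StrictToNonStrict using () renaming (_≤_ to NonStrict)
open import Relation.Binary.Core using (Rel)
open import Relation.Binary.Definitions using (Tri; tri<; tri≈; tri>)
open import Relation.Binary.PropositionalEquality
  using (_≡_; _≢_; refl; sym; trans; cong; subst; subst₂)
open import Relation.Binary.Structures using (IsStrictPartialOrder; IsStrictTotalOrder)
open import Relation.Nullary using (¬_; Dec; yes; no; contradiction)
open import Relation.Nullary.Decidable using (map′; decidable-stable)
open import Relation.Unary using (Pred; _∈_; _⊆_; _≐_; _∪_; _∩_; _⊢_; ⋃; ｛_｝)

private
  variable
    ℓ : Level

-- Diagonal enumeration of pairs of naturals.

next : ℕ × ℕ → ℕ × ℕ
next (i , zero)    = zero , ℕ.suc i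
next (i , ℕ.suc n) = ℕ.suc i , n

diagonal : ℕ → ℕ × ℕ
diagonal zero      = zero , zero
diagonal (ℕ.suc m) = next (diagonal m)

diagonal-surjective : ∀ i n → ∃ λ m → diagonal m ≡ (i , n)
diagonal-surjective i n = onDiagonal (i ℕ.+ n) i n refl
  where
  -- The recursion undoes `next`: back along an antidiagonal, then to the end of the previous one.
  onDiagonal : ∀ d i n → i ℕ.+ n ≡ d → ∃ λ m → diagonal m ≡ (i , n)
  onDiagonal d         (ℕ.suc i) n         eq
    with m , p ← onDiagonal d i (ℕ.suc n) (trans (ℕ.+-suc i n) eq) = ℕ.suc m , cong next p
  onDiagonal d         zero      zero      eq = zero , refl
  onDiagonal (ℕ.suc d) zero      (ℕ.suc n) eq
    with m , p ← onDiagonal d n zero (trans (ℕ.+-identityʳ n) (ℕ.suc-injective eq)) =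
    ℕ.suc m , cong next p

next-proj₁-≤ : ∀ x → proj₁ (next x) ℕ.≤ ℕ.suc (proj₁ x)
next-proj₁-≤ (i , zero)    = z≤n
next-proj₁-≤ (i , ℕ.suc n) = ℕ.≤-refl

diagonal-proj₁-≤ : ∀ m → proj₁ (diagonal m) ℕ.≤ m
diagonal-proj₁-≤ zero      = z≤n
diagonal-proj₁-≤ (ℕ.suc m) =
  ℕ.≤-trans (next-proj₁-≤ (diagonal m)) (s≤s (diagonal-proj₁-≤ m))

-- The `m`-th pair has first entry at most `m`, so an index of `(i , n)` has the form `i + j`. Hence
-- a node `i` levels above a limit can be coded `j` levels further up, never below itself.
diagonal-from : ∀ i n → ∃ λ j → diagonal (i ℕ.+ j) ≡ (i , n)
diagonal-from i n with m , eq ← diagonal-surjective i n =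
  m ℕ.∸ i ,
  trans (cong diagonal (ℕ.m+[n∸m]≡n (subst (ℕ._≤ m) (cong proj₁ eq) (diagonal-proj₁-≤ m)))) eq

-- Order and special sets in a single tree.

module TreeProperties (T : Tree ℓ) where
  open Tree T
  open IsStrictPartialOrder isStrictPartialOrder public
    using () renaming (irrefl to <-irrefl; trans to <-trans)

  infix 4 _≤_ _⋖_

  _≤_ : Rel Node ℓ
  _≤_ = NonStrict _≡_ _<_

  ≤-<-trans : ∀ {s t u} → s ≤ t → t < u → s < u
  ≤-<-trans (inj₁ s<t)  t<u = <-trans s<t t<u
  ≤-<-trans (inj₂ refl) t<u = t<u

  <-≤-trans : ∀ {s t u} → s < t → t ≤ u → s < u
  <-≤-trans s<t (inj₁ t<u)  = <-trans s<t t<u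
  <-≤-trans s<t (inj₂ refl) = s<t

  compare-below : ∀ {s t u} → s < u → t < u → Tri (s < t) (s ≡ t) (t < s)
  compare-below {u = u} s<u t<u =
    IsStrictTotalOrder.compare (below-isStrictTotalOrder u) (_ , s<u) (_ , t<u)

  -- Whatever is below an element of t↓ is again in t↓, so accessibility within t↓ is accessibility
  -- in the whole tree.
  <-wellFounded : WellFounded _<_
  <-wellFounded t = acc λ {s} s<t → accessible (below-wellFounded t (s , s<t))
    where
    accessible : ∀ {t} {x : ∃ (Below t)} → Acc _ x → Acc _<_ (proj₁ x)
    accessible {x = x} (acc rs) =
      acc λ {y} y<x → accessible (rs {y , <-trans y<x (proj₂ x)} y<x)

  root-minimal : ∀ {t} → ¬ t < root
  root-minimal t<root = <-irrefl refl (<-trans (root-least t≢root) t<root)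
    where
    t≢root : _ ≢ root
    t≢root refl = <-irrefl refl t<root

  antichain-special : ∀ {A} → IsAntichain A → Special A
  antichain-special {A} anti = (λ _ → A) , (λ _ → anti) , (λ a → 0 , a) , proj₂

  Special-⋃ : ∀ {B : ℕ → Pred Node ℓ} → (∀ n → Special (B n)) → Special (⋃ ℕ B)
  Special-⋃ {B} sp =
    (λ m → piece (diagonal m)) ,
    (λ m → let n , k = diagonal m in proj₁ (proj₂ (sp n)) k) ,
    (λ {t} (n , b) →
      let k , a  = proj₁ (proj₂ (proj₂ (sp n))) b
          m , eq = diagonal-surjective n k
      in m , subst (λ x → t ∈ piece x) (sym eq) a) ,
    (λ (m , a) → let n , k = diagonal m in n , proj₂ (proj₂ (proj₂ (sp n))) (k , a))
    where
    piece : ℕ × ℕ → Pred Node ℓ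
    piece (n , k) = proj₁ (sp n) k

  Countable-⊆ : ∀ {P Q : Pred Node ℓ} → P ⊆ Q →
                Countable (subset-setoid Q) → Countable (subset-setoid P)
  Countable-⊆ P⊆Q c = record
    { to        = λ (t , p) → to (t , P⊆Q p)
    ; cong      = Injection.cong c
    ; injective = injective
    }
    where open Injection c

  -- Immediate successors, limit nodes and codes of pairs.

  _⋖_ : Rel Node ℓ
  s ⋖ t = s < t × (∀ {u} → u < t → ¬ s < u)

  -- The root counts as a limit, so that every node is finitely many steps above one
  -- (`climb-from-limit`).
  Limit : Pred Node ℓ
  Limit t = ∀ {s} → ¬ s ⋖ t

  ⋖-functional : ∀ {s s′ t} → s ⋖ t → s′ ⋖ t → s ≡ s′
  ⋖-functional (s<t , s-max) (s′<t , s′-max) with compare-below s<t s′<t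
  ... | tri< s<s′ _ _ = contradiction s<s′ (s-max s′<t)
  ... | tri≈ _ eq _   = eq
  ... | tri> _ _ s′<s = contradiction s′<s (s′-max s<t)

  data Climb (s : Node) : ℕ → Node → Set ℓ where
    stay : Climb s zero s
    step : ∀ {n t u} → Climb s n t → t ⋖ u → Climb s (ℕ.suc n) u

  Climb-trans : ∀ {s t u m n} → Climb s m t → Climb t n u → Climb s (m ℕ.+ n) u
  Climb-trans {s} {u = u} {m} p stay =
    subst (λ k → Climb s k u) (sym (ℕ.+-identityʳ m)) p
  Climb-trans {s} {u = u} {m} p (step q c) =
    subst (λ k → Climb s k u) (sym (ℕ.+-suc m _)) (step (Climb-trans p q) c)

  Climb⇒≤ : ∀ {s t n} → Climb s n t → s ≤ t
  Climb⇒≤ stay             = inj₂ refl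
  Climb⇒≤ (step p (c , _)) = inj₁ (≤-<-trans (Climb⇒≤ p) c)

  -- Trees branch upwards only: each downward step is forced by `⋖-functional`.
  Climb-start-unique : ∀ {s s′ t n} → Climb s n t → Climb s′ n t → s ≡ s′
  Climb-start-unique stay       stay         = refl
  Climb-start-unique (step p c) (step p′ c′) with refl ← ⋖-functional c c′ =
    Climb-start-unique p p′

  Climb-length-unique : ∀ {l l′ t m n} → Limit l → Limit l′ →
                        Climb l m t → Climb l′ n t → m ≡ n
  Climb-length-unique lim lim′ stay       stay         = refl
  Climb-length-unique lim lim′ stay       (step _ c)   = contradiction c lim
  Climb-length-unique lim lim′ (step _ c) stay         = contradiction c lim′
  Climb-length-unique lim lim′ (step p c) (step p′ c′) with refl ← ⋖-functional c c′ =
    cong ℕ.suc (Climb-length-unique lim lim′ p p′)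

  -- The node i + j levels above a limit node l codes the pair (s , n) with s
  -- the node i levels above l, where (i , n) is the (i + j)-th pair in the
  -- diagonal enumeration.
  Codes : Node → Node → ℕ → Set ℓ
  Codes t s n = Σ[ i ∈ ℕ ] Σ[ j ∈ ℕ ] Σ[ l ∈ Node ]
    Limit l × Climb l i s × Climb s j t × diagonal (i ℕ.+ j) ≡ (i , n)

  Codes⇒≤ : ∀ {t s n} → Codes t s n → s ≤ t
  Codes⇒≤ (_ , _ , _ , _ , _ , q , _) = Climb⇒≤ q

  -- The distance of `t` from the limit below it fixes the pair `(i , n)`. Cancelling `i` fixes `j`,
  -- and `s` is found `j` steps below `t`.
  Codes-functional : ∀ {t s s′ n n′} → Codes t s n → Codes t s′ n′ → s ≡ s′ × n ≡ n′
  Codes-functional (i , j , l , lim , p , q , eq) (i′ , j′ , l′ , lim′ , p′ , q′ , eq′)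
    with len ← Climb-length-unique lim lim′ (Climb-trans p q) (Climb-trans p′ q′)
    with refl , refl ← ,-injective (trans (sym eq) (trans (cong diagonal len) eq′))
    with refl ← ℕ.+-cancelˡ-≡ i j j′ len = Climb-start-unique q q′ , refl

  -- Classical facts on limit nodes and on NS as a σ-ideal.

  module Classical (em : ExcludedMiddle ℓ) where

    least : ∀ {P : Pred Node ℓ} {t} → t ∈ P →
            ∃ λ m → m ∈ P × m ≤ t × (∀ {u} → u < m → ¬ u ∈ P)
    least {P} {t} = go (<-wellFounded t)
      where
      go : ∀ {t} → Acc _<_ t → t ∈ P → ∃ λ m → m ∈ P × m ≤ t × (∀ {u} → u < m → ¬ u ∈ P)
      go {t} (acc rs) p with em {∃ λ u → u < t × u ∈ P}
      ... | no  none = t , p , inj₂ refl , λ u<t u∈P → none (_ , u<t , u∈P)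
      ... | yes (u , u<t , u∈P) with m , m∈P , m≤u , min ← go (rs u<t) u∈P =
        m , m∈P , inj₁ (≤-<-trans m≤u u<t) , min

    Limit-or-⋖ : ∀ t → Limit t ⊎ ∃ (_⋖ t)
    Limit-or-⋖ t with em {∃ (_⋖ t)}
    ... | yes c = inj₂ c
    ... | no ¬c = inj₁ λ c → ¬c (_ , c)

    climb-from-limit : ∀ t → Σ[ l ∈ Node ] Σ[ n ∈ ℕ ] Limit l × Climb l n t
    climb-from-limit t = go (<-wellFounded t)
      where
      go : ∀ {t} → Acc _<_ t → Σ[ l ∈ Node ] Σ[ n ∈ ℕ ] Limit l × Climb l n t
      go {t} (acc rs) with Limit-or-⋖ t
      ... | inj₁ lim     = t , zero , lim , stay
      ... | inj₂ (s , c) with l , n , lim , p ← go (rs (proj₁ c)) = l , ℕ.suc n , lim , step p c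

    climb-below-limit : ∀ {s t} → Limit t → s < t → ∀ n → ∃ λ u → u < t × Climb s n u
    climb-below-limit lim s<t zero = _ , s<t , stay
    climb-below-limit {t = t} lim s<t (ℕ.suc n)
      with u , u<t , p ← climb-below-limit lim s<t n
      -- A least node `w` above `u` on the way to `t` covers `u`; it cannot be `t`, which is a
      -- limit.
      with least {u <_} u<t
    ... | w , u<w , inj₁ w<t  , min = w , w<t , step p (u<w , min)
    ... | w , u<w , inj₂ refl , min = ⊥-elim (lim (u<w , min))

    Codes-below-limit : ∀ {s t} → Limit t → s < t → ∀ n → ∃ λ u → u < t × Codes u s n
    Codes-below-limit {s} lim s<t n
      with l , i , lim-l , p ← climb-from-limit s
      with j , eq ← diagonal-from i n
      with u , u<t , q ← climb-below-limit lim s<t j =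
      u , u<t , i , j , l , lim-l , p , q , eq

    -- Each node follows the regressive map of one set containing it, so a fibre is covered by
    -- countably many special fibres.
    NS-⋃ : ∀ {B : ℕ → Pred Node ℓ} → (∀ n → NS (B n)) → NS (⋃ ℕ B)
    NS-⋃ {B} ns =
      (λ t → glue t em) , (λ {t} → regressive t em) ,
      λ u → Special-⊆ T (λ {t} (m , e) → fibre t em m e)
                        (Special-⋃ (λ n → proj₂ (proj₂ (ns n)) u))
      where
      glue : ∀ t → Dec (t ∈ ⋃ ℕ B) → Node
      glue t (yes (n , _)) = proj₁ (ns n) t
      glue t (no  _)       = t

      regressive : ∀ t (d : Dec (t ∈ ⋃ ℕ B)) → t ∈ ⋃ ℕ B → t ≢ root → glue t d < t
      regressive t (yes (n , b)) _ = proj₁ (proj₂ (ns n)) b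
      regressive t (no ¬b)       b = contradiction b ¬b

      fibre : ∀ t (d : Dec (t ∈ ⋃ ℕ B)) {u} → t ∈ ⋃ ℕ B → u ≡ glue t d →
              t ∈ ⋃ ℕ (λ n → B n ∩ (proj₁ (ns n) ⊢ ｛ u ｝))
      fibre t (yes (n , b)) _ e = n , b , e
      fibre t (no ¬b)       b e = contradiction b ¬b

    -- The predecessor map is regressive, and the immediate successors of a fixed node form an
    -- antichain.
    NS-successors : NS (λ t → ∃ (_⋖ t))
    NS-successors =
      (λ t → predecessor t em) , (λ {t} c _ → proj₁ (covers t em c)) ,
      λ u → Special-⊆ T (λ {t} (c , e) → subst (_⋖ t) (sym e) (covers t em c))
                        (antichain-special (successors-antichain u))
      where
      predecessor : ∀ t → Dec (∃ (_⋖ t)) → Node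
      predecessor t (yes (s , _)) = s
      predecessor t (no  _)       = t

      covers : ∀ t (d : Dec (∃ (_⋖ t))) → ∃ (_⋖ t) → predecessor t d ⋖ t
      covers t (yes (_ , c)) _ = c
      covers t (no ¬c)       c = contradiction c ¬c

      successors-antichain : ∀ u → IsAntichain (u ⋖_)
      successors-antichain u (u<s , _) (_ , u-max) s<t = u-max s<t u<s

-- Lowering an increasing map to a level preserving one.

module _ (S T : Tree ℓ) where
  private
    module S where
      open Tree S public
      open TreeProperties S public
    module T where
      open Tree T public
      open TreeProperties T public

  -- Comparing heights by back-and-forth avoids choosing ordinals to represent
  -- them, and unfolding a well-founded recursion that defines h.
  data SameHeight (s : S.Node) (t : T.Node) : Set ℓ where
    sameHeight : (∀ {s′} → s′ S.< s → ∃ λ t′ → t′ T.< t × SameHeight s′ t′) →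
                 (∀ {t′} → t′ T.< t → ∃ λ s′ → s′ S.< s × SameHeight s′ t′) →
                 SameHeight s t

  -- Going back along the first matching and forth along the second turns a counterexample into one
  -- with smaller matchings.
  SameHeight-irrefl : ∀ {s t t′} → SameHeight s t → SameHeight s t′ → ¬ t′ T.< t
  SameHeight-irrefl (sameHeight _ back) (sameHeight forth _) t′<t
    with s′ , s′<s , eq′ ← back t′<t
    with t″ , t″<t′ , eq″ ← forth s′<s = SameHeight-irrefl eq′ eq″ t″<t′

  -- Distinct nodes of a tree may have equal height, hence the common bound `u`.
  SameHeight-unique : ∀ {s t t′ u} → SameHeight s t → SameHeight s t′ →
                      t T.< u → t′ T.< u → t ≡ t′
  SameHeight-unique eq eq′ t<u t′<u with T.compare-below t<u t′<u
  ... | tri< t<t′ _ _ = contradiction t<t′ (SameHeight-irrefl eq′ eq)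
  ... | tri≈ _ t≡t′ _ = t≡t′
  ... | tri> _ _ t′<t = contradiction t′<t (SameHeight-irrefl eq eq′)

  LevelPreserving : (S.Node → T.Node) → Set ℓ
  LevelPreserving h = (∀ {s s′} → s′ S.< s → h s′ T.< h s)
                    × (∀ {s t} → t T.< h s → ∃ λ s′ → s′ S.< s × h s′ ≡ t)

  levelPreserving : ExcludedMiddle ℓ → S ≤ᵀ T → ∃ LevelPreserving
  levelPreserving em (g , g-mono) = h , mono , onto
    where
    open T.Classical em using (least)

    lowered : ∀ s → ∃ λ t → t T.≤ g s × SameHeight s t
    lowered s = go (S.<-wellFounded s)
      where
      go : ∀ {s} → Acc S._<_ s → ∃ λ t → t T.≤ g s × SameHeight s t
      go {s} (acc rs) = t , t≤gs , sameHeight above back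
        where
        -- `Above t` says that `t` is at least as high as `s`; the least such node at or below `g s`
        -- becomes `h s`.
        Above : Pred T.Node _
        Above t = ∀ {s′} → s′ S.< s → ∃ λ t′ → t′ T.< t × SameHeight s′ t′

        gs-above : Above (g s)
        gs-above s′<s with t′ , t′≤gs′ , eq ← go (rs s′<s) =
          t′ , T.≤-<-trans t′≤gs′ (g-mono s′<s) , eq

        minimal = least {λ t → Above t} (λ {s′} → gs-above {s′})
        t       = proj₁ minimal
        t≤gs    = proj₁ (proj₂ (proj₂ minimal))

        above : Above t
        above = proj₁ (proj₂ minimal)

        back : ∀ {t′} → t′ T.< t → ∃ λ s′ → s′ S.< s × SameHeight s′ t′
        -- A `t′` matching no `s′ < s` would itself satisfy `Above`, against the minimality of `t`.
        back {t′} t′<t = decidable-stable em λ none →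
          proj₂ (proj₂ (proj₂ minimal)) t′<t λ s′<s → below none s′<s (above s′<s)
          where
          below : ¬ (∃ λ s′ → s′ S.< s × SameHeight s′ t′) → ∀ {s′} → s′ S.< s →
                  (∃ λ t″ → t″ T.< t × SameHeight s′ t″) →
                  ∃ λ t″ → t″ T.< t′ × SameHeight s′ t″
          below none s′<s (t″ , t″<t , eq) with T.compare-below t″<t t′<t
          ... | tri< t″<t′ _ _ = t″ , t″<t′ , eq
          ... | tri≈ _ refl _  = contradiction (_ , s′<s , eq) none
          ... | tri> _ _ t′<t″ with sameHeight _ back″ ← eq
                               with s″ , s″<s′ , eq′ ← back″ t′<t″ =
            contradiction (s″ , S.<-trans s″<s′ s′<s , eq′) none

    h : S.Node → T.Node
    h s = proj₁ (lowered s)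

    h-sameHeight : ∀ s → SameHeight s (h s)
    h-sameHeight s = proj₂ (proj₂ (lowered s))

    h≤g : ∀ s → h s T.≤ g s
    h≤g s = proj₁ (proj₂ (lowered s))

    mono : ∀ {s s′} → s′ S.< s → h s′ T.< h s
    mono {s} {s′} s′<s
      with sameHeight forth _ ← h-sameHeight s
      with t , t<hs , eq ← forth s′<s
      -- `t` and `h s′` both match `s′` and both lie below `g s`, so they coincide.
      with refl ← SameHeight-unique eq (h-sameHeight s′)
                    (T.<-≤-trans t<hs (h≤g s)) (T.≤-<-trans (h≤g s′) (g-mono s′<s)) = t<hs

    onto : ∀ {s t} → t T.< h s → ∃ λ s′ → s′ S.< s × h s′ ≡ t
    onto {s} t<hs
      with sameHeight _ back ← h-sameHeight s
      with s′ , s′<s , eq ← back t<hs =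
      s′ , s′<s , SameHeight-unique (h-sameHeight s′) eq (mono s′<s) t<hs

  -- Heights and preimages under a level preserving map.

  module LevelPreservingProperties {h} (h-levelPreserving : LevelPreserving h) where
    private
      mono : ∀ {s s′} → s′ S.< s → h s′ T.< h s
      mono = proj₁ h-levelPreserving

      onto : ∀ {s t} → t T.< h s → ∃ λ s′ → s′ S.< s × h s′ ≡ t
      onto = proj₂ h-levelPreserving

    injective-below : ∀ {s s′ u} → s S.< u → s′ S.< u → h s ≡ h s′ → s ≡ s′
    injective-below s<u s′<u eq with S.compare-below s<u s′<u
    ... | tri< s<s′ _ _ = contradiction (mono s<s′) (T.<-irrefl eq)
    ... | tri≈ _ s≡s′ _ = s≡s′
    ... | tri> _ _ s′<s = contradiction (mono s′<s) (T.<-irrefl (sym eq))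

    cancel-below : ∀ {s s′ u} → s S.< u → s′ S.< u → h s T.< h s′ → s S.< s′
    cancel-below s<u s′<u lt with S.compare-below s<u s′<u
    ... | tri< s<s′ _ _ = s<s′
    ... | tri≈ _ refl _ = contradiction lt (T.<-irrefl refl)
    ... | tri> _ _ s′<s = contradiction (T.<-trans lt (mono s′<s)) (T.<-irrefl refl)

    -- Both s↓ and s′↓ are copies of the same (h s)↓. Hence a fibre of `h` lies in a single level.
    ht-cong : ∀ {s s′} → h s ≡ h s′ → S.ht s ≅ S.ht s′
    ht-cong {s} {s′} eq = (λ x → to x , to-below x) , record
      { isOrderMonomorphism = record
        { isOrderHomomorphism = record
          { cong = λ {x} {y} x≡y → injective-below (to-below x) (to-below y)
                     (trans (h-to x) (trans (cong h x≡y) (sym (h-to y))))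
          ; mono = λ {x} {y} x<y → cancel-below (to-below x) (to-below y)
                     (subst₂ T._<_ (sym (h-to x)) (sym (h-to y)) (mono x<y))
          }
        ; injective = λ {x} {y} tx≡ty → injective-below (proj₂ x) (proj₂ y)
                     (trans (sym (h-to x)) (trans (cong h tx≡ty) (h-to y)))
        ; cancel = λ {x} {y} tx<ty → cancel-below (proj₂ x) (proj₂ y)
                     (subst₂ T._<_ (h-to x) (h-to y) (mono tx<ty))
        }
      ; surjective = λ (y , y<s′) →
          let x , x<s , hx≡hy = onto (subst (h y T.<_) (sym eq) (mono y<s′))
          in (x , x<s) , λ {z} z≡x → injective-below (to-below z) y<s′
               (trans (h-to z) (trans (cong h z≡x) hx≡hy))
      }
      where
      matching : (x : ∃ (S.Below s)) → ∃ λ y → y S.< s′ × h y ≡ h (proj₁ x)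
      matching (x , x<s) = onto (subst (h x T.<_) eq (mono x<s))

      to : ∃ (S.Below s) → S.Node
      to x = proj₁ (matching x)

      to-below : ∀ x → to x S.< s′
      to-below x = proj₁ (proj₂ (matching x))

      h-to : ∀ x → h (to x) ≡ h (proj₁ x)
      h-to x = proj₂ (proj₂ (matching x))

    Special-preimage : ∀ {B} → T.Special B → S.Special (h ⊢ B)
    Special-preimage (A , anti , B⊆A , A⊆B) =
      (λ n → h ⊢ A n) , (λ n a a′ s<s′ → anti n a a′ (mono s<s′)) , B⊆A , A⊆B

    module Classical (em : ExcludedMiddle ℓ) where

      NS-preimage : ∀ {A} → T.NS A → S.NS (h ⊢ A)
      NS-preimage {A} (f , f-reg , f-fib) =
        (λ s → pull s em) , (λ {s} → regressive s em) ,
        -- The value `u` at `s` forces `f (h s)` to be `h u`, except at the root, which has no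
        -- predecessors and is sent to itself.
        λ u → Special-⊆ S (λ {s} (a , e) → fibre s em a e)
                (Special-∪ S (Special-preimage (f-fib (h u)))
                             (S.antichain-special root-antichain))
        where
        Preimage : S.Node → S.Node → Set ℓ
        Preimage s s′ = s′ S.< s × h s′ ≡ f (h s)

        pull : ∀ s → Dec (∃ (Preimage s)) → S.Node
        pull s (yes (s′ , _)) = s′
        pull s (no  _)        = s

        has-preimage : ∀ {s} → h s ∈ A → s ≢ S.root → ∃ (Preimage s)
        has-preimage a s≢root = onto (f-reg a λ hs≡root →
          T.root-minimal (subst (h S.root T.<_) hs≡root (mono (S.root-least s≢root))))

        regressive : ∀ s (d : Dec (∃ (Preimage s))) → h s ∈ A → s ≢ S.root → pull s d S.< s
        regressive s (yes (_ , s′<s , _)) _ _      = s′<s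
        regressive s (no none)            a s≢root = contradiction (has-preimage a s≢root) none

        fibre : ∀ s (d : Dec (∃ (Preimage s))) {u} → h s ∈ A → u ≡ pull s d →
                s ∈ ((h ⊢ (A ∩ (f ⊢ ｛ h u ｝))) ∪ ｛ S.root ｝)
        fibre s (yes (_ , _ , eq)) a refl = inj₁ (a , eq)
        fibre s (no none)          a _    =
          inj₂ (sym (decidable-stable em (none ∘ has-preimage a)))

        root-antichain : S.IsAntichain ｛ S.root ｝
        root-antichain refl refl = S.<-irrefl refl

      fibre-countable : (∀ α → Countable (S.subset-setoid S.Level[ α ])) →
                        ∀ t → Countable (S.subset-setoid (h ⊢ ｛ t ｝))
      fibre-countable levels t with em {∃ (h ⊢ ｛ t ｝)}
      ... | yes (s₀ , t≡hs₀) =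
        S.Countable-⊆ (λ t≡hs → ht-cong (trans (sym t≡hs) t≡hs₀)) (levels (S.ht s₀))
      ... | no empty = record
        { to        = λ x → contradiction x empty
        ; cong      = λ {x} → contradiction x empty
        ; injective = λ {x} → contradiction x empty
        }

      -- Transfer of the diamond sequence.

      module _ (levels : ∀ α → Countable (S.subset-setoid S.Level[ α ]))
               (D : S.Node → Pred S.Node ℓ) (D-below : ∀ s → D s ⊆ S.Below s) where

        private
          index : ∀ t → ∃ (h ⊢ ｛ t ｝) → ℕ
          index t = Injection.to (fibre-countable levels t)

        decode : ℕ → S.Node → Pred T.Node ℓ
        decode n s u = ∃₂ λ s′ v → s′ ∈ D s × S.Codes s′ v n × h v ≡ u

        -- `index t` is injective, so at most one `x` contributes; if none has index `n`, the guess
        -- is empty.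
        guess : ℕ → T.Node → Pred T.Node ℓ
        guess n t u = Σ[ x ∈ ∃ (h ⊢ ｛ t ｝) ] index t x ≡ n × u ∈ decode n (proj₁ x)

        guess-below : ∀ n t → guess n t ⊆ T.Below t
        guess-below n t ((s , refl) , _ , s′ , v , d , c , refl) =
          mono (S.≤-<-trans (S.Codes⇒≤ c) (D-below s d))

        -- All codes of a pair are included, so that whichever code lies below a given limit node
        -- can be used.
        encode : (ℕ → Pred T.Node ℓ) → Pred S.Node ℓ
        encode X s = ∃₂ λ v n → S.Codes s v n × h v ∈ X n

        guess-correct : ∀ X {s} → S.Limit s → (encode X ∩ S.Below s) ≐ D s →
                        ∃ λ n → (X n ∩ T.Below (h s)) ≐ guess n (h s)
        guess-correct X {s} lim (code⊆D , D⊆code) = n , to-guess , from-guess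
          where
          -- With the number of `s` in its own fibre, the guess at `h s` consults `s` and no other
          -- node.
          n = index (h s) (s , refl)

          to-guess : (X n ∩ T.Below (h s)) ⊆ guess n (h s)
          to-guess (u∈X , u<hs)
            with v , v<s , refl ← onto u<hs
            with s′ , s′<s , c ← S.Classical.Codes-below-limit em lim v<s n =
            (s , refl) , refl , s′ , v , code⊆D ((v , n , c , u∈X) , s′<s) , c , refl

          from-guess : guess n (h s) ⊆ (X n ∩ T.Below (h s))
          from-guess g@((s₁ , e) , ix , s′ , v , d , c , refl)
            with refl ← Injection.injective (fibre-countable levels (h s))
                          {s₁ , e} {s , refl} ix
            with (v′ , n′ , c′ , hv′∈X) , _ ← D⊆code d
            with refl , refl ← S.Codes-functional c c′ = hv′∈X , guess-below n (h s) g

        guessed-NS : ∀ X → (∀ n → T.NS (λ t → (X n ∩ T.Below t) ≐ guess n t)) →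
                     S.NS (λ s → (encode X ∩ S.Below s) ≐ D s)
        guessed-NS X ns = NS-⊆ S cover
          (NS-∪ S em (S.Classical.NS-successors em)
                     (S.Classical.NS-⋃ em λ n → NS-preimage (ns n)))
          where
          cover : ∀ {s} → (encode X ∩ S.Below s) ≐ D s →
                  s ∈ ((λ s → ∃ (S._⋖ s)) ∪
                       ⋃ ℕ (λ n s → (X n ∩ T.Below (h s)) ≐ guess n (h s)))
          cover {s} eq with S.Classical.Limit-or-⋖ em s
          ... | inj₁ lim = inj₂ (guess-correct X lim eq)
          ... | inj₂ c   = inj₁ c

        some-guess-◇ : ExcludedMiddle (suc ℓ) →
                       (∀ X → ¬ S.NS (λ s → (X ∩ S.Below s) ≐ D s)) →
                       ∃ λ n → ∀ X → ¬ T.NS (λ t → (X ∩ T.Below t) ≐ guess n t)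
        some-guess-◇ em⁺ D-guesses = decidable-stable em⁺ λ none →
          let
            -- Since `em⁺` decides Σ-types, `failure` returns actual witnesses, which form the
            -- sequence to be encoded.
            failure : ∀ n → ∃ λ X → T.NS (λ t → (X ∩ T.Below t) ≐ guess n t)
            failure n = decidable-stable em⁺ λ ¬failure →
              none (n , λ X ns → ¬failure (X , ns))
          in
          D-guesses (encode (proj₁ ∘ failure)) (guessed-NS (proj₁ ∘ failure) (proj₂ ∘ failure))

theorem3p17 : ∀ {ℓ : Level} (em : ExcludedMiddle (suc ℓ)) (S T : Tree ℓ) →
    HasHeightω₁ S → HasHeightω₁ T → S ≤ᵀ T →
    (NS-ideal T em ≤K NS-ideal S em)
    × (Nonspecial S → Isω₁Tree S → ◇ S → ◇ T)
theorem3p17 {ℓ} em S T _ _ S≤T =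
  (h , λ _ → NS-preimage) ,
  λ _ (_ , levels) (D , D-below , D-guesses) →
    let n , guesses = some-guess-◇ levels D D-below em D-guesses
    in guess levels D D-below n , guess-below levels D D-below n , guesses
  where
  em₀ : ExcludedMiddle ℓ
  em₀ = map′ lower lift em

  h = proj₁ (levelPreserving S T em₀ S≤T)

  open LevelPreservingProperties S T (proj₂ (levelPreserving S T em₀ S≤T))
  open Classical em₀
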